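{- The binary tree $T^4_2$ of height 4 has a fractional pebbling using $8/3$ pebbles when white sliding moves are allowed.
   Context: $T^4_2$ is the balanced rooted binary tree with 4 levels (15 nodes). A fractional configuration assigns to each node $i$ reals $b(i),w(i)\ge 0$ with $b(i)+w(i)\le1$; the number of pebbles is $\sum_i(b(i)+w(i))$. Moves: (i) decrease any $b(i)$; (ii) increase any $w(i)$; (iii) if both children of $i$ have $b+w=1$ (vacuous for leaves), set $w(i)=0$, increase $b(i)$ arbitrarily, and simultaneously decrease black values of the children arbitrarily; and, with white sliding moves allowed, (iv) for an internal node $i$ with $w(i)=1$ and a child $j$ such that every other child of $i$ has pebble value $1$, decrease $w(i)$ to $0$ and increase $w(j)$ so that $j$ has pebble value $1$. A fractional pebbling using $p$ pebbles starts and ends with all values $0$, has the root with black value $1$ at some point, and never exceeds $p$ pebbles. -}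

module Defs where

open import Data.Nat using (ℕ; zero; suc; _<_)
import Data.Nat as ℕ
import Data.Fin
open import Data.Fin using (Fin; toℕ)
open import Data.Integer using (+_)
open import Data.Rational using (ℚ; _+_; _≤_; 0ℚ; 1ℚ; _/_)
open import Data.List using (List; foldr; map; allFin)
open import Data.Product using (_×_; _,_; proj₁; proj₂; ∃-syntax; Σ-syntax)
open import Data.Sum using (_⊎_)
open import Relation.Nullary using (¬_)
open import Relation.Binary.PropositionalEquality using (_≡_; _≢_)

-- Nodes of T^4_2 (balanced binary tree with 4 levels, 15 nodes) in heap
-- order: node 0 is the root, the children of node i are 2i+1 and 2i+2.
-- Nodes 0..6 are internal, nodes 7..14 are leaves.
Node : Set
Node = Fin 15

root : Node
root = Data.Fin.zero

Child : Node → Node → Set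
Child i j = (toℕ j ≡ 2 ℕ.* toℕ i ℕ.+ 1) ⊎ (toℕ j ≡ 2 ℕ.* toℕ i ℕ.+ 2)

Internal : Node → Set
Internal i = toℕ i < 7

-- A configuration: each node carries (black value b, white value w).
Config : Set
Config = Node → ℚ × ℚ

b : Config → Node → ℚ
b c i = proj₁ (c i)

w : Config → Node → ℚ
w c i = proj₂ (c i)

val : Config → Node → ℚ
val c i = b c i + w c i

empty : Config
empty _ = 0ℚ , 0ℚ

Valid : Config → Set
Valid c = ∀ i → (0ℚ ≤ b c i) × (0ℚ ≤ w c i) × (val c i ≤ 1ℚ)

pebbles : Config → ℚ
pebbles c = foldr _+_ 0ℚ (map (val c) (allFin 15))

SameExcept : Node → Config → Config → Set
SameExcept i c c' = ∀ k → k ≢ i → c' k ≡ c k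

data Step (c c' : Config) : Set where
  decB : (i : Node) → SameExcept i c c' →
         w c' i ≡ w c i → b c' i ≤ b c i → Step c c'
  incW : (i : Node) → SameExcept i c c' →
         b c' i ≡ b c i → w c i ≤ w c' i → Step c c'
  -- (iii) if both children of i are full (vacuous for leaves): set w(i)=0,
  -- increase b(i), and decrease the black values of the children
  place : (i : Node) →
          (∀ j → Child i j → val c j ≡ 1ℚ) →
          w c' i ≡ 0ℚ → b c i ≤ b c' i →
          (∀ j → Child i j → (w c' j ≡ w c j) × (b c' j ≤ b c j)) →
          (∀ k → k ≢ i → ¬ Child i k → c' k ≡ c k) → Step c c'
  slide : (i j : Node) → Internal i → w c i ≡ 1ℚ → Child i j →
          (∀ k → Child i k → k ≢ j → val c k ≡ 1ℚ) →
          b c' i ≡ b c i → w c' i ≡ 0ℚ →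
          b c' j ≡ b c j → w c j ≤ w c' j → val c' j ≡ 1ℚ →
          (∀ k → k ≢ i → k ≢ j → c' k ≡ c k) → Step c c'

record FractionalPebbling (p : ℚ) : Set where
  field
    len       : ℕ
    seq       : ℕ → Config
    start     : seq 0 ≡ empty
    finish    : seq len ≡ empty
    valid     : ∀ k → k ℕ.≤ len → Valid (seq k)
    bounded   : ∀ k → k ℕ.≤ len → pebbles (seq k) ≤ p
    steps     : ∀ k → k < len → Step (seq k) (seq (suc k))
    rootBlack : ∃[ k ] (k ℕ.≤ len × b (seq k) root ≡ 1ℚ)

eightThirds : ℚ
eightThirds = + 8 / 3

{-# OPTIONS --safe #-}
-- The pebbling leaves 1/3 black on node 6 and 1/3 black on node 1 early on.
-- These are later topped up with 2/3 white each, so that node 2 and then the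
-- root can be blackened with at most 8/3 pebbles. A white pebble on node 3 or
-- node 6 is always completed to a full one before it is removed, because a
-- white slide to a leaf requires only one extra pebble, on the sibling leaf,
-- instead of the two that blackening the node would require.

module Submission where

open import Data.Bool using (if_then_else_)
open import Data.Fin using (#_)
open import Data.Fin.Properties using (all?) renaming (_≟_ to _≟ᶠ_)
open import Data.Integer using (+_)
open import Data.List using (List; []; _∷_; length)
open import Data.Nat using (ℕ; zero; suc; s≤s)
import Data.Nat as ℕ
import Data.Nat.Properties as ℕ
open import Data.Product using (_×_; _,_; proj₁; proj₂)
open import Data.Product.Properties using (≡-dec)
open import Data.Rational using (_+_; _≤_; 0ℚ; 1ℚ; _/_)
open import Data.Rational.Properties using (_≟_; _≤?_)
open import Relation.Binary.PropositionalEquality using (_≡_; _≢_; refl)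
open import Relation.Nullary using (Dec; ¬_; does; ¬?; _×-dec_; _⊎-dec_; _→-dec_)
open import Relation.Nullary.Decidable using (toWitness)

open import Defs

data Move : Set where
  decB incW place : Node → Move
  slide : Node → Node → Move

-- Once the move is named, the hypotheses of a `Step` become a product of comparisons and
-- quantifiers over the finite type `Node`, so they can be decided by evaluation.
Legal : Move → Config → Config → Set
Legal (decB i) c c' =
  SameExcept i c c' × w c' i ≡ w c i × b c' i ≤ b c i
Legal (incW i) c c' =
  SameExcept i c c' × b c' i ≡ b c i × w c i ≤ w c' i
Legal (place i) c c' =
  (∀ j → Child i j → val c j ≡ 1ℚ) ×
  w c' i ≡ 0ℚ × b c i ≤ b c' i ×
  (∀ j → Child i j → (w c' j ≡ w c j) × (b c' j ≤ b c j)) ×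
  (∀ k → k ≢ i → ¬ Child i k → c' k ≡ c k)
Legal (slide i j) c c' =
  Internal i × w c i ≡ 1ℚ × Child i j ×
  (∀ k → Child i k → k ≢ j → val c k ≡ 1ℚ) ×
  b c' i ≡ b c i × w c' i ≡ 0ℚ ×
  b c' j ≡ b c j × w c j ≤ w c' j × val c' j ≡ 1ℚ ×
  (∀ k → k ≢ i → k ≢ j → c' k ≡ c k)

legal⇒step : ∀ m {c c'} → Legal m c c' → Step c c'
legal⇒step (decB i) (same , w≡ , b≤) = decB i same w≡ b≤
legal⇒step (incW i) (same , b≡ , w≤) = incW i same b≡ w≤
legal⇒step (place i) (full , w≡0 , b≤ , children , same) =
  place i full w≡0 b≤ children same
legal⇒step (slide i j)
  (internal , w≡1 , child , full , b≡ , w≡0 , bj≡ , wj≤ , val≡1 , same) =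
  slide i j internal w≡1 child full b≡ w≡0 bj≡ wj≤ val≡1 same

child? : ∀ i j → Dec (Child i j)
child? i j = (_ ℕ.≟ _) ⊎-dec (_ ℕ.≟ _)

legal? : ∀ m c c' → Dec (Legal m c c')
legal? m c c' = go m
  where
  same? : ∀ k → Dec (c' k ≡ c k)
  same? k = ≡-dec _≟_ _≟_ (c' k) (c k)

  _≢?_ : (i j : Node) → Dec (i ≢ j)
  i ≢? j = ¬? (i ≟ᶠ j)

  go : ∀ m → Dec (Legal m c c')
  go (decB i) =
    all? (λ k → k ≢? i →-dec same? k) ×-dec (_ ≟ _) ×-dec (_ ≤? _)
  go (incW i) =
    all? (λ k → k ≢? i →-dec same? k) ×-dec (_ ≟ _) ×-dec (_ ≤? _)
  go (place i) =
    all? (λ j → child? i j →-dec (_ ≟ _)) ×-dec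
    (_ ≟ _) ×-dec (_ ≤? _) ×-dec
    all? (λ j → child? i j →-dec ((_ ≟ _) ×-dec (_ ≤? _))) ×-dec
    all? (λ k → k ≢? i →-dec (¬? (child? i k) →-dec same? k))
  go (slide i j) =
    (_ ℕ.<? _) ×-dec (_ ≟ _) ×-dec child? i j ×-dec
    all? (λ k → child? i k →-dec (k ≢? j →-dec (_ ≟ _))) ×-dec
    (_ ≟ _) ×-dec (_ ≟ _) ×-dec
    (_ ≟ _) ×-dec (_ ≤? _) ×-dec (_ ≟ _) ×-dec
    all? (λ k → k ≢? i →-dec (k ≢? j →-dec same? k))

valid? : ∀ c → Dec (Valid c)
valid? c = all? λ i → (_ ≤? _) ×-dec (_ ≤? _) ×-dec (_ ≤? _)

infix 6 _●_ _○_

-- n ● i and n ○ i stand for n/3 black, respectively white, pebbles on node i.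
data Pebble : Set where
  _●_ _○_ : ℕ → Node → Pebble

config : List Pebble → Config
config [] _ = 0ℚ , 0ℚ
config (n ● i ∷ ps) j = let x , y = config ps j in
  if does (i ≟ᶠ j) then (+ n / 3 + x , y) else (x , y)
config (n ○ i ∷ ps) j = let x , y = config ps j in
  if does (i ≟ᶠ j) then (x , + n / 3 + y) else (x , y)

-- Each configuration is paired with the move that leaves it; the configuration
-- after the last move is empty.
trace : List (List Pebble × Move)
trace =
  ([]                                           , place (# 13)) ∷
  (3 ● # 13 ∷ []                                , place (# 14)) ∷
  (3 ● # 13 ∷ 3 ● # 14 ∷ []                     , place (# 6)) ∷
  (1 ● # 6 ∷ []                                 , place (# 9)) ∷
  (1 ● # 6 ∷ 3 ● # 9 ∷ []                       , place (# 10)) ∷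
  (1 ● # 6 ∷ 3 ● # 9 ∷ 3 ● # 10 ∷ []            , place (# 4)) ∷
  -- Node 3 gets white because blackening it here would need both its leaves, 1 + 1/3 + 2 > 8/3 in
  -- total.
  (3 ● # 4 ∷ 1 ● # 6 ∷ []                       , incW (# 3)) ∷
  (3 ○ # 3 ∷ 3 ● # 4 ∷ 1 ● # 6 ∷ []             , place (# 1)) ∷
  (1 ● # 1 ∷ 3 ○ # 3 ∷ 1 ● # 6 ∷ []             , place (# 8)) ∷
  (1 ● # 1 ∷ 3 ○ # 3 ∷ 1 ● # 6 ∷ 3 ● # 8 ∷ []   , slide (# 3) (# 7)) ∷
  -- On a leaf, `place` with zero black increase simply removes the white pebble.
  (1 ● # 1 ∷ 1 ● # 6 ∷ 3 ○ # 7 ∷ 3 ● # 8 ∷ []   , place (# 7)) ∷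
  (1 ● # 1 ∷ 1 ● # 6 ∷ 3 ● # 8 ∷ []             , decB (# 8)) ∷
  (1 ● # 1 ∷ 1 ● # 6 ∷ []                       , place (# 11)) ∷
  (1 ● # 1 ∷ 1 ● # 6 ∷ 3 ● # 11 ∷ []            , place (# 12)) ∷
  -- The bound is attained: beside two full leaves, only 2/3 is left for nodes 1 and 6 together.
  (1 ● # 1 ∷ 1 ● # 6 ∷ 3 ● # 11 ∷ 3 ● # 12 ∷ [] , place (# 5)) ∷
  (1 ● # 1 ∷ 3 ● # 5 ∷ 1 ● # 6 ∷ []             , incW (# 6)) ∷
  (1 ● # 1 ∷ 3 ● # 5 ∷ 1 ● # 6 ∷ 2 ○ # 6 ∷ []   , place (# 2)) ∷
  -- `place` lowers only the black values of the children, so the white 2/3 on node 6 survives as a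
  -- debt.
  (1 ● # 1 ∷ 3 ● # 2 ∷ 2 ○ # 6 ∷ []             , incW (# 1)) ∷
  (1 ● # 1 ∷ 2 ○ # 1 ∷ 3 ● # 2 ∷ 2 ○ # 6 ∷ []   , place (# 0)) ∷
  (3 ● # 0 ∷ 2 ○ # 1 ∷ 2 ○ # 6 ∷ []             , decB (# 0)) ∷
  (2 ○ # 1 ∷ 2 ○ # 6 ∷ []                       , incW (# 6)) ∷
  (2 ○ # 1 ∷ 3 ○ # 6 ∷ []                       , place (# 14)) ∷
  (2 ○ # 1 ∷ 3 ○ # 6 ∷ 3 ● # 14 ∷ []            , slide (# 6) (# 13)) ∷
  (2 ○ # 1 ∷ 3 ○ # 13 ∷ 3 ● # 14 ∷ []           , place (# 13)) ∷
  (2 ○ # 1 ∷ 3 ● # 14 ∷ []                      , decB (# 14)) ∷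
  (2 ○ # 1 ∷ []                                 , place (# 9)) ∷
  (2 ○ # 1 ∷ 3 ● # 9 ∷ []                       , place (# 10)) ∷
  (2 ○ # 1 ∷ 3 ● # 9 ∷ 3 ● # 10 ∷ []            , place (# 4)) ∷
  (2 ○ # 1 ∷ 3 ● # 4 ∷ []                       , incW (# 3)) ∷
  -- Both children of node 1 are full, so `place` clears its white 2/3 without adding black.
  (2 ○ # 1 ∷ 3 ○ # 3 ∷ 3 ● # 4 ∷ []             , place (# 1)) ∷
  (3 ○ # 3 ∷ []                                 , place (# 8)) ∷
  (3 ○ # 3 ∷ 3 ● # 8 ∷ []                       , slide (# 3) (# 7)) ∷
  (3 ○ # 7 ∷ 3 ● # 8 ∷ []                       , place (# 7)) ∷
  (3 ● # 8 ∷ []                                 , decB (# 8)) ∷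
  []

nth : ∀ {A : Set} → A → List A → ℕ → A
nth d []       _       = d
nth d (x ∷ _)  zero    = x
nth d (_ ∷ xs) (suc k) = nth d xs k

-- Past the end of `trace` the default `[]` applies; it supplies the final empty configuration at
-- index `length trace`.
configAt : ℕ → Config
configAt k = config (proj₁ (nth ([] , decB root) trace k))

moveAt : ℕ → Move
moveAt k = proj₂ (nth ([] , decB root) trace k)

trace-valid : ∀ {k} → k ℕ.< suc (length trace) → Valid (configAt k)
trace-valid =
  toWitness {a? = ℕ.allUpTo? (λ k → valid? (configAt k)) (suc (length trace))} _

trace-bounded : ∀ {k} → k ℕ.< suc (length trace) →
                pebbles (configAt k) ≤ eightThirds
trace-bounded = toWitness
  {a? = ℕ.allUpTo? (λ k → pebbles (configAt k) ≤? eightThirds) (suc (length trace))} _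

trace-legal : ∀ {k} → k ℕ.< length trace →
              Legal (moveAt k) (configAt k) (configAt (suc k))
trace-legal = toWitness
  {a? = ℕ.allUpTo? (λ k → legal? (moveAt k) (configAt k) (configAt (suc k))) (length trace)} _

theorem4p12 : FractionalPebbling eightThirds
theorem4p12 = record
  { len       = length trace
  ; seq       = configAt
  ; start     = refl
  ; finish    = refl
  ; valid     = λ _ k≤len → trace-valid (s≤s k≤len)
  ; bounded   = λ _ k≤len → trace-bounded (s≤s k≤len)
  ; steps     = λ k k<len → legal⇒step (moveAt k) (trace-legal k<len)
  -- Counting from 0, entry 19 of `trace` is the one with `3 ● # 0`.
  ; rootBlack = 19 , toWitness {a? = 19 ℕ.≤? length trace} _ , refl
  }
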